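{- Let $A$ be a formula and $\Gamma$ a context of higher-order logic. (1) For each $* \in \{\mathfrak{e}, \mathfrak{e}\mathfrak{p}\}$: if $\Gamma \vdash_c^* A$ then $\Gamma_{Ku} \vdash_i^* A^{Ku}$. (2) For each $* \in \{\mathfrak{e}\mathfrak{f}, \mathfrak{e}\mathfrak{f}\mathfrak{p}\}$: if $\Gamma \vdash_c^* A$ then $\Delta^{\mathfrak{f}}, \Gamma_{Ku} \vdash_i^* A^{Ku}$.
   Context: Syntax. Simple types are generated by: $\iota$ (individuals), $o$ (propositions), and $\tau \to \sigma$ for types $\tau,\sigma$. For each type $\tau$ there are a set $\mathcal{V}_\tau$ of variables (infinitely many, as usual) and a set $\mathcal{C}_\tau$ of constants; variables and constants are disjoint. Terms are simply typed: variables and constants of type $\tau$ are terms of type $\tau$; if $x\in\mathcal{V}_\tau$ and $t$ has type $\sigma$, then $\lambda x.t$ has type $\tau\to\sigma$; if $t$ has type $\tau\to\sigma$ and $u$ has type $\tau$, then $t\,u$ has type $\sigma$. Terms are taken up to renaming of bound variables; $t[x\leftarrow u]$ is capture-avoiding substitution; $\equiv_\beta$ is the congruence generated by $(\lambda x.t)u \hookrightarrow t[x\leftarrow u]$ (no $\eta$). Formulas are terms of type $o$. The constants include $\top,\bot$ of type $o$; $\neg$ of type $o\to o$; $\Rightarrow,\wedge,\vee$ of type $o\to o\to o$; and for every type $\tau$, $\forall_\tau,\exists_\tau$ of type $(\tau\to o)\to o$ and $=_\tau$ of type $\tau\to\tau\to o$ (written infix); there may be further constants. $\forall x.A$ and $\exists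 x.A$ abbreviate $\forall_\tau(\lambda x.A)$, $\exists_\tau(\lambda x.A)$; $A\Leftrightarrow B := (A\Rightarrow B)\wedge(B\Rightarrow A)$. $FV$ denotes free variables. A context is a finite sequence of formulas. Derivability. Intuitionistic logic has the usual natural deduction rules: introduction and elimination for $\Rightarrow,\wedge,\vee$; Not-I: from $\Gamma,A\vdash\bot$ infer $\Gamma\vdash\neg A$; Not-E: from $\Gamma\vdash\neg A$ and $\Gamma\vdash A$ infer $\Gamma\vdash\bot$; Bot-E: from $\Gamma\vdash\bot$ infer $\Gamma\vdash A$; Top-I: $\Gamma\vdash\top$; All-I: from $\Gamma\vdash P\,x$ with $x\notin FV(\Gamma,P)$ infer $\Gamma\vdash\forall P$; All-E: from $\Gamma\vdash\forall P$ infer $\Gamma\vdash P\,t$; Ex-I: from $\Gamma\vdash P\,t$ infer $\Gamma\vdash\exists P$; Ex-E: from $\Gamma\vdash\exists P$ and $\Gamma,P\,x\vdash A$ with $x\notin FV(\Gamma,P,A)$ infer $\Gamma\vdash A$; Ax: $\Gamma,A,\Delta\vdash A$; Conv: from $\Gamma\vdash A$ and $A\equiv_\beta B$ infer $\Gamma\vdash B$. Classical logic adds PEM: $\Gamma\vdash A\vee\neg A$. $\Gamma\vdash_i A$ and $\Gamma\vdash_c A$ denote intuitionistic and classical derivability. Equality rules. Eq-I: $\Gamma\vdash u=u$. Eq-E: from $\Gamma\vdash P\,u$ and $\Gamma\vdash u=v$ infer $\Gamma\vdash P\,v$. FunExt: from $\Gamma\vdash f\,x=g\,x$ with $x\notin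 FV(\Gamma,f,g)$ infer $\Gamma\vdash f=g$. PropExt: from $\Gamma\vdash A\Leftrightarrow B$ infer $\Gamma\vdash A=B$. For $k\in\{c,i\}$ and $*\in\{\mathfrak{e},\mathfrak{e}\mathfrak{p},\mathfrak{e}\mathfrak{f},\mathfrak{e}\mathfrak{f}\mathfrak{p}\}$, $\Gamma\vdash_k^* A$ means derivability in the logic $k$ with the additional rules Eq-I and Eq-E if $\mathfrak{e}$ occurs in $*$, PropExt if $\mathfrak{p}$ occurs in $*$, and FunExt if $\mathfrak{f}$ occurs in $*$. Kuroda's translation. For a term $t$, $t_{Ku}$ is defined by: $x_{Ku}:=x$ for variables; $(\forall_\tau)_{Ku}:=\lambda p.\forall_\tau(\lambda x.\neg\neg(p\,x))$ for each type $\tau$; $c_{Ku}:=c$ for every other constant; $(\lambda x.t)_{Ku}:=\lambda x.t_{Ku}$; $(t\,u)_{Ku}:=t_{Ku}\,u_{Ku}$. For a formula $A$, $A^{Ku}:=\neg\neg A_{Ku}$. For a context $\Gamma=A_1,\dots,A_n$, $\Gamma_{Ku}:=(A_1)_{Ku},\dots,(A_n)_{Ku}$. $\Delta^{\mathfrak{f}}$ is $\forall f\,\forall g.\,(\forall x.\,\neg\neg(f\,x=g\,x))\Rightarrow\neg\neg(f=g)$, with $f,g$ of type $\tau\to\sigma$ and $x$ of type $\tau$, for all types $\tau,\sigma$; having $\Delta^{\mathfrak{f}}$ in a context means that finitely many of these type instances may be used as hypotheses. -}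

module Defs where

open import Data.List using (List; []; _∷_; _++_; map; concatMap)
open import Data.List.Membership.Propositional using (_∈_; _∉_)
open import Data.List.Relation.Unary.Any using (here; there)
open import Data.Nat using (ℕ)
open import Data.Product using (Σ; _×_; _,_)
open import Level using (Level)
open import Relation.Binary.PropositionalEquality using (_≡_; refl)

infixr 20 _⟶_

data Ty : Set where
  ι o : Ty
  _⟶_ : Ty → Ty → Ty

record Var (τ : Ty) : Set where
  constructor var
  field index : ℕ

-- C τ is the set of further constants of type τ, beyond the logical ones.
data Con {ℓ : Level} (C : Ty → Set ℓ) : Ty → Set ℓ where
  ⊤ᶜ ⊥ᶜ    : Con C o
  ¬ᶜ       : Con C (o ⟶ o)
  ⇒ᶜ ∧ᶜ ∨ᶜ : Con C (o ⟶ o ⟶ o)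
  ∀ᶜ ∃ᶜ    : (τ : Ty) → Con C ((τ ⟶ o) ⟶ o)
  =ᶜ       : (τ : Ty) → Con C (τ ⟶ τ ⟶ o)
  further  : ∀ {τ} → C τ → Con C τ

-- Terms up to renaming of bound variables: free variables are the named
-- elements of Var τ, bound variables are well-scoped de Bruijn indices, and Δ
-- lists the types of the enclosing binders. The ordinary terms, whose
-- variables are each either bound by a ƛ or free and named, are those with
-- Δ = [].
infixl 15 _·_

data Term {ℓ : Level} (C : Ty → Set ℓ) (Δ : List Ty) : Ty → Set ℓ where
  free  : ∀ {τ} → Var τ → Term C Δ τ
  bound : ∀ {τ} → τ ∈ Δ → Term C Δ τ
  con   : ∀ {τ} → Con C τ → Term C Δ τ
  ƛ     : ∀ {τ σ} → Term C (τ ∷ Δ) σ → Term C Δ (τ ⟶ σ)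
  _·_   : ∀ {τ σ} → Term C Δ (τ ⟶ σ) → Term C Δ τ → Term C Δ σ

Formula : ∀ {ℓ} → (Ty → Set ℓ) → Set ℓ
Formula C = Term C [] o

-- The most recent hypothesis comes first: the sequence written Γ , A is A ∷ Γ.
Context : ∀ {ℓ} → (Ty → Set ℓ) → Set ℓ
Context C = List (Formula C)

private variable
  ℓ     : Level
  C     : Ty → Set ℓ
  Δ Δ′  : List Ty
  τ σ ρ : Ty

infix  10 _≐_
infix  9  ¬̇_
infixr 8  _∧̇_
infixr 7  _∨̇_
infixr 6  _⇒̇_
infix  5  _⇔̇_

⊤̇ ⊥̇ : Term C Δ o
⊤̇ = con ⊤ᶜ
⊥̇ = con ⊥ᶜ

¬̇_ : Term C Δ o → Term C Δ o
¬̇ A = con ¬ᶜ · A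

_⇒̇_ _∧̇_ _∨̇_ _⇔̇_ : Term C Δ o → Term C Δ o → Term C Δ o
A ⇒̇ B = con ⇒ᶜ · A · B
A ∧̇ B = con ∧ᶜ · A · B
A ∨̇ B = con ∨ᶜ · A · B
A ⇔̇ B = (A ⇒̇ B) ∧̇ (B ⇒̇ A)

∀̇ ∃̇ : Term C Δ (τ ⟶ o) → Term C Δ o
∀̇ P = con (∀ᶜ _) · P
∃̇ P = con (∃ᶜ _) · P

_≐_ : Term C Δ τ → Term C Δ τ → Term C Δ o
t ≐ u = con (=ᶜ _) · t · u

FV : Term C Δ τ → List (Σ Ty Var)
FV (free x)  = (_ , x) ∷ []
FV (bound _) = []
FV (con _)   = []
FV (ƛ t)     = FV t
FV (t · u)   = FV t ++ FV u

infix 4 _∉FV_ _∉FVᶜ_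

_∉FV_ : Var τ → Term C Δ σ → Set
x ∉FV t = (_ , x) ∉ FV t

_∉FVᶜ_ : Var τ → Context C → Set
x ∉FVᶜ Γ = (_ , x) ∉ concatMap FV Γ

Ren : List Ty → List Ty → Set
Ren Δ Δ′ = ∀ {τ} → τ ∈ Δ → τ ∈ Δ′

liftRen : Ren Δ Δ′ → Ren (ρ ∷ Δ) (ρ ∷ Δ′)
liftRen r (here e)  = here e
liftRen r (there i) = there (r i)

rename : Ren Δ Δ′ → Term C Δ τ → Term C Δ′ τ
rename r (free x)  = free x
rename r (bound i) = bound (r i)
rename r (con c)   = con c
rename r (ƛ t)     = ƛ (rename (liftRen r) t)
rename r (t · u)   = rename r t · rename r u

Sub : (Ty → Set ℓ) → List Ty → List Ty → Set ℓ
Sub C Δ Δ′ = ∀ {τ} → τ ∈ Δ → Term C Δ′ τ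

liftSub : Sub C Δ Δ′ → Sub C (ρ ∷ Δ) (ρ ∷ Δ′)
liftSub s (here e)  = bound (here e)
liftSub s (there i) = rename there (s i)

substitute : Sub C Δ Δ′ → Term C Δ τ → Term C Δ′ τ
substitute s (free x)  = free x
substitute s (bound i) = s i
substitute s (con c)   = con c
substitute s (ƛ t)     = ƛ (substitute (liftSub s) t)
substitute s (t · u)   = substitute s t · substitute s u

single : Term C Δ ρ → Sub C (ρ ∷ Δ) Δ
single u (here refl) = u
single u (there i)   = bound i

infix 16 _[_]

_[_] : Term C (ρ ∷ Δ) τ → Term C Δ ρ → Term C Δ τ
t [ u ] = substitute (single u) t

infix 4 _≡β_

data _≡β_ {ℓ : Level} {C : Ty → Set ℓ} {Δ : List Ty} :
          ∀ {τ} → Term C Δ τ → Term C Δ τ → Set ℓ where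
  β      : (t : Term C (τ ∷ Δ) σ) (u : Term C Δ τ) → ƛ t · u ≡β t [ u ]
  ≡β-lam : {t t′ : Term C (τ ∷ Δ) σ} → t ≡β t′ → ƛ t ≡β ƛ t′
  ≡β-app : {t t′ : Term C Δ (τ ⟶ σ)} {u u′ : Term C Δ τ} →
           t ≡β t′ → u ≡β u′ → t · u ≡β t′ · u′
  ≡β-refl  : {t : Term C Δ τ} → t ≡β t
  ≡β-sym   : {t u : Term C Δ τ} → t ≡β u → u ≡β t
  ≡β-trans : {t u v : Term C Δ τ} → t ≡β u → u ≡β v → t ≡β v

data Logic : Set where
  classical intuitionistic : Logic

-- Eq-I and Eq-E belong to all four systems; 𝔭 adds PropExt and 𝔣 adds FunExt.
data EqSystem : Set where
  𝔢 𝔢𝔭 𝔢𝔣 𝔢𝔣𝔭 : EqSystem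

data HasPropExt : EqSystem → Set where
  in-𝔢𝔭  : HasPropExt 𝔢𝔭
  in-𝔢𝔣𝔭 : HasPropExt 𝔢𝔣𝔭

data HasFunExt : EqSystem → Set where
  in-𝔢𝔣  : HasFunExt 𝔢𝔣
  in-𝔢𝔣𝔭 : HasFunExt 𝔢𝔣𝔭

infix 3 _⊢[_,_]_

data Derivation {ℓ : Level} {C : Ty → Set ℓ} (k : Logic) (s : EqSystem) :
                Context C → Formula C → Set ℓ

_⊢[_,_]_ : Context C → Logic → EqSystem → Formula C → Set _
Γ ⊢[ k , s ] A = Derivation k s Γ A

data Derivation {C = C} k s where
  ax   : ∀ {Γ A} → A ∈ Γ → Γ ⊢[ k , s ] A
  conv : ∀ {Γ A B} → Γ ⊢[ k , s ] A → A ≡β B → Γ ⊢[ k , s ] B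

  ⊤-I  : ∀ {Γ} → Γ ⊢[ k , s ] ⊤̇
  ⊥-E  : ∀ {Γ A} → Γ ⊢[ k , s ] ⊥̇ → Γ ⊢[ k , s ] A

  ¬-I  : ∀ {Γ A} → A ∷ Γ ⊢[ k , s ] ⊥̇ → Γ ⊢[ k , s ] ¬̇ A
  ¬-E  : ∀ {Γ A} → Γ ⊢[ k , s ] ¬̇ A → Γ ⊢[ k , s ] A → Γ ⊢[ k , s ] ⊥̇

  ⇒-I  : ∀ {Γ A B} → A ∷ Γ ⊢[ k , s ] B → Γ ⊢[ k , s ] A ⇒̇ B
  ⇒-E  : ∀ {Γ A B} → Γ ⊢[ k , s ] A ⇒̇ B → Γ ⊢[ k , s ] A → Γ ⊢[ k , s ] B

  ∧-I  : ∀ {Γ A B} → Γ ⊢[ k , s ] A → Γ ⊢[ k , s ] B → Γ ⊢[ k , s ] A ∧̇ B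
  ∧-E₁ : ∀ {Γ A B} → Γ ⊢[ k , s ] A ∧̇ B → Γ ⊢[ k , s ] A
  ∧-E₂ : ∀ {Γ A B} → Γ ⊢[ k , s ] A ∧̇ B → Γ ⊢[ k , s ] B

  ∨-I₁ : ∀ {Γ A B} → Γ ⊢[ k , s ] A → Γ ⊢[ k , s ] A ∨̇ B
  ∨-I₂ : ∀ {Γ A B} → Γ ⊢[ k , s ] B → Γ ⊢[ k , s ] A ∨̇ B
  ∨-E  : ∀ {Γ A B D} → Γ ⊢[ k , s ] A ∨̇ B →
         A ∷ Γ ⊢[ k , s ] D → B ∷ Γ ⊢[ k , s ] D → Γ ⊢[ k , s ] D

  ∀-I  : ∀ {Γ τ} {P : Term C [] (τ ⟶ o)} (x : Var τ) →
         x ∉FVᶜ Γ → x ∉FV P →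
         Γ ⊢[ k , s ] P · free x → Γ ⊢[ k , s ] ∀̇ P
  ∀-E  : ∀ {Γ τ} {P : Term C [] (τ ⟶ o)} (t : Term C [] τ) →
         Γ ⊢[ k , s ] ∀̇ P → Γ ⊢[ k , s ] P · t

  ∃-I  : ∀ {Γ τ} {P : Term C [] (τ ⟶ o)} (t : Term C [] τ) →
         Γ ⊢[ k , s ] P · t → Γ ⊢[ k , s ] ∃̇ P
  ∃-E  : ∀ {Γ A τ} {P : Term C [] (τ ⟶ o)} (x : Var τ) →
         x ∉FVᶜ Γ → x ∉FV P → x ∉FV A →
         Γ ⊢[ k , s ] ∃̇ P → P · free x ∷ Γ ⊢[ k , s ] A → Γ ⊢[ k , s ] A

  pem  : ∀ {Γ A} → k ≡ classical → Γ ⊢[ k , s ] A ∨̇ (¬̇ A)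

  eq-I : ∀ {Γ τ} {u : Term C [] τ} → Γ ⊢[ k , s ] u ≐ u
  eq-E : ∀ {Γ τ} {P : Term C [] (τ ⟶ o)} {u v : Term C [] τ} →
         Γ ⊢[ k , s ] P · u → Γ ⊢[ k , s ] u ≐ v → Γ ⊢[ k , s ] P · v

  funExt  : ∀ {Γ τ σ} {f g : Term C [] (τ ⟶ σ)} → HasFunExt s → (x : Var τ) →
            x ∉FVᶜ Γ → x ∉FV f → x ∉FV g →
            Γ ⊢[ k , s ] (f · free x) ≐ (g · free x) → Γ ⊢[ k , s ] f ≐ g
  propExt : ∀ {Γ} {A B : Formula C} → HasPropExt s →
            Γ ⊢[ k , s ] A ⇔̇ B → Γ ⊢[ k , s ] A ≐ B

b₀ : Term C (τ ∷ Δ) τ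
b₀ = bound (here refl)

b₁ : Term C (σ ∷ τ ∷ Δ) τ
b₁ = bound (there (here refl))

b₂ : Term C (ρ ∷ σ ∷ τ ∷ Δ) τ
b₂ = bound (there (there (here refl)))

KuCon : Con C τ → Term C Δ τ
KuCon (∀ᶜ τ) = ƛ (∀̇ (ƛ (¬̇ ¬̇ (b₁ · b₀))))
KuCon c      = con c

Ku : Term C Δ τ → Term C Δ τ
Ku (free x)  = free x
Ku (bound i) = bound i
Ku (con c)   = KuCon c
Ku (ƛ t)     = ƛ (Ku t)
Ku (t · u)   = Ku t · Ku u

infix 20 _^Ku

_^Ku : Formula C → Formula C
A ^Ku = ¬̇ ¬̇ Ku A

KuCtx : Context C → Context C
KuCtx = map Ku

-- ∀ f ∀ g. (∀ x. ¬¬ (f x = g x)) ⇒ ¬¬ (f = g)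
Δᶠ-instance : Ty × Ty → Formula C
Δᶠ-instance (τ , σ) =
  ∀̇ {τ = τ ⟶ σ} (ƛ (∀̇ {τ = τ ⟶ σ} (ƛ (
    ∀̇ {τ = τ} (ƛ (¬̇ ¬̇ ((b₂ · b₀) ≐ (b₁ · b₀)))) ⇒̇ (¬̇ ¬̇ (b₁ ≐ b₀))))))

Δᶠ : List (Ty × Ty) → Context C
Δᶠ = map Δᶠ-instance

{-# OPTIONS --safe #-}
-- By induction on the derivation, doing every inference under a double negation.
-- PEM is provable there, and the ∀ introduced by Ku carries exactly the ¬¬ that
-- ∀-I would otherwise have to move across the quantifier. FunExt meets the same
-- obstacle without any help from Ku, which is what Δᶠ is for. Admissibility of
-- weakening is never needed: a premise that has to be used under further
-- hypotheses is first discharged into an implication or a ∀, and then cut.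
module Submission where

open import Data.List using (List; []; _∷_; _++_; map; concatMap)
open import Data.List.Extrema.Nat using (max; xs≤max)
open import Data.List.Membership.Propositional using (_∈_; _∉_)
open import Data.List.Membership.Propositional.Properties
  using (∈-map⁺; ∈-++⁺ˡ; ∈-++⁺ʳ; ∈-++⁻)
open import Data.List.Properties using (++-identityʳ)
open import Data.List.Relation.Binary.Subset.Propositional using (_⊆_)
open import Data.List.Relation.Unary.All as All using ()
open import Data.List.Relation.Unary.Any using (here; there)
open import Data.Nat using (ℕ; suc)
open import Data.Nat.Properties using (1+n≰n)
open import Data.Product using (Σ; _×_; _,_; ∃-syntax)
open import Data.Sum using ([_,_]′)
open import Function using (id; _∘_)
open import Level using (Level)
open import Relation.Nullary using (¬_; contradiction)
open import Relation.Binary.PropositionalEquality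
  using (_≡_; refl; sym; trans; cong; cong₂; subst)
open import Defs

private variable
  ℓ        : Level
  C        : Ty → Set ℓ
  Δ Δ′ Δ″  : List Ty
  τ σ ρ    : Ty
  k        : Logic
  s        : EqSystem
  Γ        : Context C
  A B D    : Formula C

pattern #0 = here refl
pattern #1 = there #0
pattern #2 = there #1
pattern #3 = there #2
pattern #4 = there #3

-- Renaming and substitution.

weaken : Term C Δ τ → Term C (ρ ∷ Δ) τ
weaken = rename there

rename-id : {r : Ren Δ Δ} → (∀ {τ} (i : τ ∈ Δ) → r i ≡ i) →
            (t : Term C Δ τ) → rename r t ≡ t
rename-id h (free x)  = refl
rename-id h (bound i) = cong bound (h i)
rename-id h (con c)   = refl
rename-id h (ƛ t)     = cong ƛ (rename-id (λ { (here e) → refl ; (there i) → cong there (h i) }) t)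
rename-id h (t · u)   = cong₂ _·_ (rename-id h t) (rename-id h u)

rename-rename : {r : Ren Δ Δ′} {r′ : Ren Δ′ Δ″} {r″ : Ren Δ Δ″} →
                (∀ {τ} (i : τ ∈ Δ) → r′ (r i) ≡ r″ i) →
                (t : Term C Δ τ) → rename r′ (rename r t) ≡ rename r″ t
rename-rename h (free x)  = refl
rename-rename h (bound i) = cong bound (h i)
rename-rename h (con c)   = refl
rename-rename h (ƛ t)     =
  cong ƛ (rename-rename (λ { (here e) → refl ; (there i) → cong there (h i) }) t)
rename-rename h (t · u)   = cong₂ _·_ (rename-rename h t) (rename-rename h u)

substitute-rename : {r : Ren Δ Δ′} {θ : Sub C Δ′ Δ″} {r′ : Ren Δ Δ″} →
                    (∀ {τ} (i : τ ∈ Δ) → θ (r i) ≡ bound (r′ i)) →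
                    (t : Term C Δ τ) → substitute θ (rename r t) ≡ rename r′ t
substitute-rename h (free x)  = refl
substitute-rename h (bound i) = h i
substitute-rename h (con c)   = refl
substitute-rename h (ƛ t)     =
  cong ƛ (substitute-rename (λ { (here e) → refl ; (there i) → cong weaken (h i) }) t)
substitute-rename h (t · u)   = cong₂ _·_ (substitute-rename h t) (substitute-rename h u)

weaken-[] : (t : Term C Δ τ) (u : Term C Δ ρ) → weaken t [ u ] ≡ t
weaken-[] t u = trans (substitute-rename {r′ = id} (λ _ → refl) t) (rename-id (λ _ → refl) t)

-- Needed to instantiate `Δᶠ-instance` twice: the first function then sits under the quantifiers
-- over the second function and over the argument, and the second substitution must cancel one of
-- its two weakenings.
weaken²-lift-[] : (t : Term C Δ τ) (u : Term C Δ ρ) →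
                  substitute (liftSub {ρ = σ} (single u)) (weaken (weaken t)) ≡ weaken t
weaken²-lift-[] t u =
  trans (cong (substitute _) (rename-rename {r″ = there ∘ there} (λ _ → refl) t))
        (substitute-rename (λ _ → refl) t)

FV-rename : (r : Ren Δ Δ′) (t : Term C Δ τ) → FV (rename r t) ≡ FV t
FV-rename r (free x)  = refl
FV-rename r (bound i) = refl
FV-rename r (con c)   = refl
FV-rename r (ƛ t)     = FV-rename (liftRen r) t
FV-rename r (t · u)   = cong₂ _++_ (FV-rename r t) (FV-rename r u)

-- Compatibility of Kuroda's translation with substitution, conversion and free variables.

KuCon-rename : (r : Ren Δ Δ′) (c : Con C τ) → rename r (KuCon c) ≡ KuCon c
KuCon-rename r ⊤ᶜ          = refl
KuCon-rename r ⊥ᶜ          = refl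
KuCon-rename r ¬ᶜ          = refl
KuCon-rename r ⇒ᶜ          = refl
KuCon-rename r ∧ᶜ          = refl
KuCon-rename r ∨ᶜ          = refl
KuCon-rename r (∀ᶜ τ)      = refl
KuCon-rename r (∃ᶜ τ)      = refl
KuCon-rename r (=ᶜ τ)      = refl
KuCon-rename r (further c) = refl

KuCon-substitute : (θ : Sub C Δ Δ′) (c : Con C τ) → substitute θ (KuCon c) ≡ KuCon c
KuCon-substitute θ ⊤ᶜ          = refl
KuCon-substitute θ ⊥ᶜ          = refl
KuCon-substitute θ ¬ᶜ          = refl
KuCon-substitute θ ⇒ᶜ          = refl
KuCon-substitute θ ∧ᶜ          = refl
KuCon-substitute θ ∨ᶜ          = refl
KuCon-substitute θ (∀ᶜ τ)      = refl
KuCon-substitute θ (∃ᶜ τ)      = refl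
KuCon-substitute θ (=ᶜ τ)      = refl
KuCon-substitute θ (further c) = refl

FV-KuCon : (c : Con C τ) → FV (KuCon {Δ = Δ} c) ≡ []
FV-KuCon ⊤ᶜ          = refl
FV-KuCon ⊥ᶜ          = refl
FV-KuCon ¬ᶜ          = refl
FV-KuCon ⇒ᶜ          = refl
FV-KuCon ∧ᶜ          = refl
FV-KuCon ∨ᶜ          = refl
FV-KuCon (∀ᶜ τ)      = refl
FV-KuCon (∃ᶜ τ)      = refl
FV-KuCon (=ᶜ τ)      = refl
FV-KuCon (further c) = refl

Ku-rename : (r : Ren Δ Δ′) (t : Term C Δ τ) → Ku (rename r t) ≡ rename r (Ku t)
Ku-rename r (free x)  = refl
Ku-rename r (bound i) = refl
Ku-rename r (con c)   = sym (KuCon-rename r c)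
Ku-rename r (ƛ t)     = cong ƛ (Ku-rename (liftRen r) t)
Ku-rename r (t · u)   = cong₂ _·_ (Ku-rename r t) (Ku-rename r u)

-- The pointwise hypothesis is stable under `liftSub`, so the induction passes binders without
-- function extensionality.
Ku-substitute : {θ θ′ : Sub C Δ Δ′} → (∀ {τ} (i : τ ∈ Δ) → Ku (θ i) ≡ θ′ i) →
                (t : Term C Δ τ) → Ku (substitute θ t) ≡ substitute θ′ (Ku t)
Ku-substitute h (free x)  = refl
Ku-substitute h (bound i) = h i
Ku-substitute h (con c)   = sym (KuCon-substitute _ c)
Ku-substitute {θ = θ} h (ƛ t) =
  cong ƛ (Ku-substitute
    (λ { (here e) → refl ; (there i) → trans (Ku-rename there (θ i)) (cong weaken (h i)) }) t)
Ku-substitute h (t · u)   = cong₂ _·_ (Ku-substitute h t) (Ku-substitute h u)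

Ku-[] : (t : Term C (ρ ∷ Δ) τ) (u : Term C Δ ρ) → Ku (t [ u ]) ≡ Ku t [ Ku u ]
Ku-[] t u = Ku-substitute (λ { (here refl) → refl ; (there i) → refl }) t

Ku-≡β : {t u : Term C Δ τ} → t ≡β u → Ku t ≡β Ku u
Ku-≡β (β t u)        = subst (ƛ (Ku t) · Ku u ≡β_) (sym (Ku-[] t u)) (β (Ku t) (Ku u))
Ku-≡β (≡β-lam e)     = ≡β-lam (Ku-≡β e)
Ku-≡β (≡β-app e e′)  = ≡β-app (Ku-≡β e) (Ku-≡β e′)
Ku-≡β ≡β-refl        = ≡β-refl
Ku-≡β (≡β-sym e)     = ≡β-sym (Ku-≡β e)
Ku-≡β (≡β-trans e f) = ≡β-trans (Ku-≡β e) (Ku-≡β f)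

FV-Ku : (t : Term C Δ τ) → FV (Ku t) ≡ FV t
FV-Ku (free x)  = refl
FV-Ku (bound i) = refl
FV-Ku (con c)   = FV-KuCon c
FV-Ku (ƛ t)     = FV-Ku t
FV-Ku (t · u)   = cong₂ _++_ (FV-Ku t) (FV-Ku u)

FV-Δᶠ : (L : List (Ty × Ty)) → concatMap FV (Δᶠ {C = C} L) ≡ []
FV-Δᶠ []      = refl
FV-Δᶠ (_ ∷ L) = FV-Δᶠ L

-- Instances of `Δᶠ` are closed, so eigenvariable conditions on `Γ` carry over to the translated
-- context.
FV-KuCtx-Δᶠ : (Γ : Context C) (L : List (Ty × Ty)) →
              concatMap FV (KuCtx Γ ++ Δᶠ L) ≡ concatMap FV Γ
FV-KuCtx-Δᶠ {C = C} [] L = FV-Δᶠ {C = C} L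
FV-KuCtx-Δᶠ (A ∷ Γ)    L = cong₂ _++_ (FV-Ku A) (FV-KuCtx-Δᶠ Γ L)

fresh : (xs : List (Σ Ty Var)) → ∃[ x ] (τ , x) ∉ xs
-- The index exceeds every index in `xs`, whatever the type attached to it.
fresh {τ} xs = var (suc (max 0 (map index xs))) ,
               λ p → 1+n≰n (All.lookup (xs≤max 0 (map index xs)) (∈-map⁺ index p))
  where
  index : Σ Ty Var → ℕ
  index (_ , x) = Var.index x

-- Propositional reasoning under a double negation.

¬¬-I : Γ ⊢[ k , s ] A → Γ ⊢[ k , s ] ¬̇ ¬̇ A
¬¬-I d = ⇒-E (⇒-I (¬-I (¬-E (ax #0) (ax #1)))) d

¬¬⊥-E : Γ ⊢[ k , s ] ¬̇ ¬̇ ⊥̇ → Γ ⊢[ k , s ] ⊥̇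
¬¬⊥-E d = ¬-E d (¬-I (ax #0))

¬¬-bind : Γ ⊢[ k , s ] ¬̇ ¬̇ A → A ∷ Γ ⊢[ k , s ] ¬̇ ¬̇ B → Γ ⊢[ k , s ] ¬̇ ¬̇ B
¬¬-bind d e =
  ⇒-E (⇒-E (⇒-I (⇒-I (¬-I (¬-E (ax #1) (¬-I (¬-E (⇒-E (ax #3) (ax #0)) (ax #1)))))))
           (⇒-I e)) d

¬¬-map : Γ ⊢[ k , s ] ¬̇ ¬̇ A → A ∷ Γ ⊢[ k , s ] B → Γ ⊢[ k , s ] ¬̇ ¬̇ B
¬¬-map d e = ¬¬-bind d (¬¬-I e)

¬¬-map₂ : Γ ⊢[ k , s ] ¬̇ ¬̇ A → Γ ⊢[ k , s ] ¬̇ ¬̇ B → B ∷ A ∷ Γ ⊢[ k , s ] D →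
          Γ ⊢[ k , s ] ¬̇ ¬̇ D
¬¬-map₂ d e f =
  ⇒-E (⇒-E (⇒-E
    (⇒-I (⇒-I (⇒-I (¬¬-bind (ax #1) (¬¬-map (ax #1) (⇒-E (⇒-E (ax #4) (ax #1)) (ax #0)))))))
    (⇒-I (⇒-I f))) d) e

-- Suppose `A ⇒̇ B` fails. Then `B` fails, since it would imply `A ⇒̇ B`; so `A` is absurd by the
-- premise, and `A ⇒̇ B` follows by `⊥-E`.
¬¬-⇒-I : A ∷ Γ ⊢[ k , s ] ¬̇ ¬̇ B → Γ ⊢[ k , s ] ¬̇ ¬̇ (A ⇒̇ B)
¬¬-⇒-I d =
  ⇒-E (⇒-I (¬-I (¬-E (ax #0) (⇒-I (⊥-E
        (¬-E (⇒-E (ax #2) (ax #0)) (¬-I (¬-E (ax #2) (⇒-I (ax #1))))))))))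
      (⇒-I d)

¬¬-∨-E : Γ ⊢[ k , s ] ¬̇ ¬̇ (A ∨̇ B) → A ∷ Γ ⊢[ k , s ] ¬̇ ¬̇ D → B ∷ Γ ⊢[ k , s ] ¬̇ ¬̇ D →
         Γ ⊢[ k , s ] ¬̇ ¬̇ D
¬¬-∨-E d e f =
  ⇒-E (⇒-E (⇒-E
    (⇒-I (⇒-I (⇒-I (¬¬-bind (ax #0)
      (∨-E (ax #0) (⇒-E (ax #4) (ax #0)) (⇒-E (ax #3) (ax #0)))))))
    (⇒-I e)) (⇒-I f)) d

¬¬-pem : Γ ⊢[ k , s ] ¬̇ ¬̇ (A ∨̇ (¬̇ A))
¬¬-pem = ¬-I (¬-E (ax #0) (∨-I₂ (¬-I (¬-E (ax #1) (∨-I₁ (ax #0))))))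

∉-++ : {xs ys : List (Σ Ty Var)} {x : Σ Ty Var} → x ∉ xs → x ∉ ys → x ∉ xs ++ ys
∉-++ {xs} x∉xs x∉ys p = [ x∉xs , x∉ys ]′ (∈-++⁻ xs p)

-- Quantifiers and function extensionality under a double negation.

∀¬¬-body : Term C [] (τ ⟶ o) → Term C [] (τ ⟶ o)
∀¬¬-body P = ƛ (¬̇ ¬̇ (weaken P · b₀))

∀¬¬-body-β : (P : Term C [] (τ ⟶ o)) (t : Term C [] τ) →
             ∀¬¬-body P · t ≡β ¬̇ ¬̇ (P · t)
∀¬¬-body-β P t = subst (λ u → ∀¬¬-body P · t ≡β ¬̇ ¬̇ (u · t)) (weaken-[] P t) (β _ _)

Ku-∀ : (P : Term C [] (τ ⟶ o)) → Ku (∀̇ P) ≡β ∀̇ (∀¬¬-body (Ku P))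
Ku-∀ P = β _ _

∀¬¬-I : {P : Term C [] (τ ⟶ o)} (x : Var τ) → x ∉FVᶜ Γ → x ∉FV P →
        Γ ⊢[ k , s ] ¬̇ ¬̇ (P · free x) → Γ ⊢[ k , s ] ∀̇ (∀¬¬-body P)
∀¬¬-I {P = P} x x∉Γ x∉P d =
  ∀-I x x∉Γ
    -- The trailing empty list comes from `b₀`, which has no free variables.
    (subst ((_ , x) ∉_) (sym (trans (++-identityʳ _) (FV-rename there P))) x∉P)
    (conv d (≡β-sym (∀¬¬-body-β P (free x))))

-- The minor premise is generalised over `x` to `∀̇ Q`. Under the double negation, a witness of
-- `∃̇ P` is then named by a fresh `y` and fed to `Q`; the goal is already doubly negated.
¬¬-∃-E : {P : Term C [] (τ ⟶ o)} (x : Var τ) → x ∉FVᶜ Γ → x ∉FV P → x ∉FV A →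
         Γ ⊢[ k , s ] ¬̇ ¬̇ ∃̇ P → P · free x ∷ Γ ⊢[ k , s ] ¬̇ ¬̇ A → Γ ⊢[ k , s ] ¬̇ ¬̇ A
¬¬-∃-E {τ = τ} {Γ = Γ} {A = A} {k = k} {s = s} {P = P} x x∉Γ x∉P x∉A d e =
  ⇒-E (⇒-E (⇒-I (⇒-I (¬¬-bind (ax #0) generic)))
           (∀-I x x∉Γ x∉Q (conv (⇒-I e) (≡β-sym (Q·≡β x))))) d
  where
  Q : Term _ [] (τ ⟶ o)
  Q = ƛ (weaken P · b₀ ⇒̇ ¬̇ ¬̇ weaken A)
  FV-Q : FV Q ≡ FV P ++ FV A
  FV-Q = cong₂ _++_ (trans (++-identityʳ _) (FV-rename there P)) (FV-rename there A)
  x∉Q : x ∉FV Q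
  x∉Q = subst ((_ , x) ∉_) (sym FV-Q) (∉-++ x∉P x∉A)
  Q·≡β : (y : Var τ) → Q · free y ≡β (P · free y ⇒̇ ¬̇ ¬̇ A)
  Q·≡β y = subst (Q · free y ≡β_)
    (cong₂ (λ t u → t · free y ⇒̇ ¬̇ ¬̇ u) (weaken-[] P (free y)) (weaken-[] A (free y)))
    (β _ _)
  Θ = ∃̇ P ∷ ¬̇ ¬̇ ∃̇ P ∷ ∀̇ Q ∷ Γ
  generic : Θ ⊢[ k , s ] ¬̇ ¬̇ A
  -- This list also covers `FV P`, which is its first block because `∃̇ P` heads `Θ`.
  generic with y , y∉ ← fresh {τ} (concatMap FV Θ ++ FV A) =
    ∃-E y (y∉ ∘ ∈-++⁺ˡ) (y∉ ∘ ∈-++⁺ˡ ∘ ∈-++⁺ˡ) (y∉ ∘ ∈-++⁺ʳ (concatMap FV Θ))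
      (ax #0) (⇒-E (conv (∀-E (free y) (ax #3)) (Q·≡β y)) (ax #0))

¬¬-funExt : {f g : Term C [] (τ ⟶ σ)} (x : Var τ) → x ∉FVᶜ Γ → x ∉FV f → x ∉FV g →
            Δᶠ-instance (τ , σ) ∈ Γ →
            Γ ⊢[ k , s ] ¬̇ ¬̇ ((f · free x) ≐ (g · free x)) → Γ ⊢[ k , s ] ¬̇ ¬̇ (f ≐ g)
¬¬-funExt {C = C} {τ = τ} {σ = σ} {f = f} {g = g} x x∉Γ x∉f x∉g Δ∈Γ d =
  ⇒-E (conv (∀-E g (conv (∀-E f (ax Δ∈Γ)) (β _ _))) instance-β)
      (∀-I x x∉Γ x∉Q (conv d (≡β-sym Q·x≡β)))
  where
  Q : Term C [] (τ ⟶ o)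
  Q = ƛ (¬̇ ¬̇ ((weaken f · b₀) ≐ (weaken g · b₀)))
  x∉Q : x ∉FV Q
  x∉Q = subst ((_ , x) ∉_)
    (sym (cong₂ _++_ (trans (++-identityʳ _) (FV-rename there f))
                     (trans (++-identityʳ _) (FV-rename there g))))
    (∉-++ x∉f x∉g)
  Q·x≡β : Q · free x ≡β ¬̇ ¬̇ ((f · free x) ≐ (g · free x))
  Q·x≡β = subst (Q · free x ≡β_)
    (cong₂ (λ t u → ¬̇ ¬̇ ((t · free x) ≐ (u · free x))) (weaken-[] f (free x)) (weaken-[] g (free x)))
    (β _ _)
  -- The body left after `f` is supplied to the instance of `Δᶠ`, with the second function still
  -- bound.
  instance-f : Term C (τ ⟶ σ ∷ []) o
  instance-f = ∀̇ (ƛ (¬̇ ¬̇ ((weaken (weaken f) · b₀) ≐ (b₁ · b₀)))) ⇒̇ (¬̇ ¬̇ (weaken f ≐ b₀))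
  instance-β : ƛ instance-f · g ≡β (∀̇ Q ⇒̇ ¬̇ ¬̇ (f ≐ g))
  instance-β = subst (ƛ instance-f · g ≡β_)
    (cong₂ (λ t u → ∀̇ (ƛ (¬̇ ¬̇ ((t · b₀) ≐ (weaken g · b₀)))) ⇒̇ ¬̇ ¬̇ (u ≐ g))
           (weaken²-lift-[] f g) (weaken-[] f g))
    (β _ _)

-- Γ yields A once enough instances of Δᶠ are available. Taking a lower bound
-- rather than the exact list lets the premises of a rule share one list; the
-- guard HasFunExt s makes L = [] admissible in the systems without FunExt.
record KuDerivable {ℓ} {C : Ty → Set ℓ} (s : EqSystem) (Γ : Context C) (A : Formula C) :
                   Set ℓ where
  constructor derivable
  field
    instances : List (Ty × Ty)
    derive    : ∀ L → (HasFunExt s → instances ⊆ L) →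
                KuCtx Γ ++ Δᶠ L ⊢[ intuitionistic , s ] A ^Ku

-- Combining premises, and the induction on derivations.

rule₀ : (∀ L → KuCtx Γ ++ Δᶠ L ⊢[ intuitionistic , s ] A ^Ku) → KuDerivable s Γ A
rule₀ r = derivable [] λ L _ → r L

rule₁ : {Γ₁ Γ : Context C} {A₁ A : Formula C} →
        (∀ L → KuCtx Γ₁ ++ Δᶠ L ⊢[ intuitionistic , s ] A₁ ^Ku →
               KuCtx Γ ++ Δᶠ L ⊢[ intuitionistic , s ] A ^Ku) →
        KuDerivable s Γ₁ A₁ → KuDerivable s Γ A
rule₁ r (derivable L₁ d) = derivable L₁ λ L h → r L (d L h)

rule₂ : {Γ₁ Γ₂ Γ : Context C} {A₁ A₂ A : Formula C} →
        (∀ L → KuCtx Γ₁ ++ Δᶠ L ⊢[ intuitionistic , s ] A₁ ^Ku →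
               KuCtx Γ₂ ++ Δᶠ L ⊢[ intuitionistic , s ] A₂ ^Ku →
               KuCtx Γ ++ Δᶠ L ⊢[ intuitionistic , s ] A ^Ku) →
        KuDerivable s Γ₁ A₁ → KuDerivable s Γ₂ A₂ → KuDerivable s Γ A
rule₂ r (derivable L₁ d) (derivable L₂ e) =
  derivable (L₁ ++ L₂) λ L h → r L (d L λ p → h p ∘ ∈-++⁺ˡ) (e L λ p → h p ∘ ∈-++⁺ʳ L₁)

rule₃ : {Γ₁ Γ₂ Γ₃ Γ : Context C} {A₁ A₂ A₃ A : Formula C} →
        (∀ L → KuCtx Γ₁ ++ Δᶠ L ⊢[ intuitionistic , s ] A₁ ^Ku →
               KuCtx Γ₂ ++ Δᶠ L ⊢[ intuitionistic , s ] A₂ ^Ku →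
               KuCtx Γ₃ ++ Δᶠ L ⊢[ intuitionistic , s ] A₃ ^Ku →
               KuCtx Γ ++ Δᶠ L ⊢[ intuitionistic , s ] A ^Ku) →
        KuDerivable s Γ₁ A₁ → KuDerivable s Γ₂ A₂ → KuDerivable s Γ₃ A₃ → KuDerivable s Γ A
rule₃ r (derivable L₁ d) (derivable L₂ e) (derivable L₃ f) =
  derivable (L₁ ++ L₂ ++ L₃) λ L h → r L (d L λ p → h p ∘ ∈-++⁺ˡ)
                                      (e L λ p → h p ∘ ∈-++⁺ʳ L₁ ∘ ∈-++⁺ˡ)
                                      (f L λ p → h p ∘ ∈-++⁺ʳ L₁ ∘ ∈-++⁺ʳ L₂)

∉-KuCtx-Δᶠ : {x : Var τ} (Γ : Context C) (L : List (Ty × Ty)) →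
             x ∉FVᶜ Γ → x ∉FVᶜ KuCtx Γ ++ Δᶠ L
∉-KuCtx-Δᶠ Γ L = subst (_ ∉_) (sym (FV-KuCtx-Δᶠ Γ L))

∉-Ku : {x : Var τ} (t : Term C Δ σ) → x ∉FV t → x ∉FV Ku t
∉-Ku t = subst (_ ∉_) (sym (FV-Ku t))

kuroda : Γ ⊢[ k , s ] A → KuDerivable s Γ A
kuroda (ax A∈Γ)      = rule₀ λ L → ¬¬-I (ax (∈-++⁺ˡ (∈-map⁺ Ku A∈Γ)))
kuroda (conv d A≡B)  = rule₁ (λ L d → ¬¬-map d (conv (ax #0) (Ku-≡β A≡B))) (kuroda d)
kuroda ⊤-I           = rule₀ λ L → ¬¬-I ⊤-I
kuroda (⊥-E d)       = rule₁ (λ L d → ⊥-E (¬¬⊥-E d)) (kuroda d)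
-- The translated premise ends in a doubly negated `⊥̇`, which collapses to `⊥̇`.
kuroda (¬-I d)       = rule₁ (λ L d → ¬¬-I (¬-I (¬¬⊥-E d))) (kuroda d)
kuroda (¬-E d e)     =
  rule₂ (λ L d e → ¬¬-map₂ d e (¬-E (ax #1) (ax #0))) (kuroda d) (kuroda e)
kuroda (⇒-I d)       = rule₁ (λ L → ¬¬-⇒-I) (kuroda d)
kuroda (⇒-E d e)     =
  rule₂ (λ L d e → ¬¬-map₂ d e (⇒-E (ax #1) (ax #0))) (kuroda d) (kuroda e)
kuroda (∧-I d e)     =
  rule₂ (λ L d e → ¬¬-map₂ d e (∧-I (ax #1) (ax #0))) (kuroda d) (kuroda e)
kuroda (∧-E₁ d)      = rule₁ (λ L d → ¬¬-map d (∧-E₁ (ax #0))) (kuroda d)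
kuroda (∧-E₂ d)      = rule₁ (λ L d → ¬¬-map d (∧-E₂ (ax #0))) (kuroda d)
kuroda (∨-I₁ d)      = rule₁ (λ L d → ¬¬-map d (∨-I₁ (ax #0))) (kuroda d)
kuroda (∨-I₂ d)      = rule₁ (λ L d → ¬¬-map d (∨-I₂ (ax #0))) (kuroda d)
kuroda (∨-E d e f)   = rule₃ (λ L → ¬¬-∨-E) (kuroda d) (kuroda e) (kuroda f)
kuroda (∀-I {Γ = Γ} {P = P} x x∉Γ x∉P d) =
  rule₁ (λ L d → ¬¬-I (conv (∀¬¬-I x (∉-KuCtx-Δᶠ Γ L x∉Γ) (∉-Ku P x∉P) d)
                            (≡β-sym (Ku-∀ P))))
        (kuroda d)
kuroda (∀-E {P = P} t d) =
  -- The double negation inside the translated quantifier merges with the outer one.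
  rule₁ (λ L d → ¬¬-bind d (conv (∀-E (Ku t) (conv (ax #0) (Ku-∀ P)))
                                 (∀¬¬-body-β (Ku P) (Ku t))))
        (kuroda d)
kuroda (∃-I t d)     = rule₁ (λ L d → ¬¬-map d (∃-I (Ku t) (ax #0))) (kuroda d)
kuroda (∃-E {Γ = Γ} {A = A} {P = P} x x∉Γ x∉P x∉A d e) =
  rule₂ (λ L → ¬¬-∃-E x (∉-KuCtx-Δᶠ Γ L x∉Γ) (∉-Ku P x∉P) (∉-Ku A x∉A)) (kuroda d) (kuroda e)
kuroda (pem _)       = rule₀ λ L → ¬¬-pem
kuroda eq-I          = rule₀ λ L → ¬¬-I eq-I
kuroda (eq-E d e)    =
  rule₂ (λ L d e → ¬¬-map₂ d e (eq-E (ax #1) (ax #0))) (kuroda d) (kuroda e)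
kuroda (funExt {Γ = Γ} {τ} {σ} {f} {g} hasFunExt x x∉Γ x∉f x∉g d)
  with derivable L₁ e ← kuroda d =
  -- The instance for this inference joins those of its premise; `hasFunExt` opens the guard, so `L`
  -- contains it.
  derivable ((τ , σ) ∷ L₁) λ L h →
    ¬¬-funExt x (∉-KuCtx-Δᶠ Γ L x∉Γ) (∉-Ku f x∉f) (∉-Ku g x∉g)
      (∈-++⁺ʳ (KuCtx Γ) (∈-map⁺ Δᶠ-instance (h hasFunExt #0)))
      (e L λ p → h p ∘ there)
kuroda (propExt hasPropExt d) =
  rule₁ (λ L d → ¬¬-map d (propExt hasPropExt (ax #0))) (kuroda d)

kuroda-without-FunExt : ¬ HasFunExt s → Γ ⊢[ k , s ] A → KuCtx Γ ⊢[ intuitionistic , s ] A ^Ku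
kuroda-without-FunExt {s = s} {A = A} ¬funExt d with derivable _ e ← kuroda d =
  -- The guard is vacuous here, so the empty list of instances is admissible.
  subst (_⊢[ intuitionistic , s ] A ^Ku) (++-identityʳ _) (e [] λ p → contradiction p ¬funExt)

theorem2 : ∀ {ℓ} (C : Ty → Set ℓ) (A : Formula C) (Γ : Context C) →
    (∀ s → s ∈ 𝔢 ∷ 𝔢𝔭 ∷ [] →
    Γ ⊢[ classical , s ] A → KuCtx Γ ⊢[ intuitionistic , s ] A ^Ku)
    ×
    (∀ s → s ∈ 𝔢𝔣 ∷ 𝔢𝔣𝔭 ∷ [] →
    Γ ⊢[ classical , s ] A →
    ∃[ instances ] (KuCtx Γ ++ Δᶠ instances ⊢[ intuitionistic , s ] A ^Ku))
theorem2 C A Γ =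
  (λ { _ #0 → kuroda-without-FunExt λ () ; _ #1 → kuroda-without-FunExt λ () }) ,
  -- The lower bound itself serves as the list of instances.
  λ s _ d → let derivable L e = kuroda d in L , e L λ _ → id
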